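{- Let $A \subset \mathbb{Z}_{>0}$ be a finite set of size $n$ whose elements are co-prime (i.e. the greatest common divisor of all elements of $A$ is $1$). Then either $A = \{1,2\}$ or $s(A) \geq (n+2)/3$.
   Context: A set $B \subset \mathbb{Z}_{>0}$ is sum-free if there are no $x,y,z \in B$ (with $x=y$ allowed) such that $x+y=z$. For a finite set $A \subset \mathbb{Z}_{>0}$, $s(A)$ denotes the size of the largest sum-free subset of $A$. -}

module Defs where

open import Data.List.Base using (List; []; _∷_; _++_; map; filter; foldr; length)
open import Data.List.Extrema.Nat using (max; argmax-sel; v≤max⁺)
open import Data.List.Membership.DecPropositional using () renaming (_∈?_ to ∈-dec)
open import Data.List.Membership.Propositional using (_∈_; lose)
open import Data.List.Membership.Propositional.Properties
  using (∈-++⁺ˡ; ∈-++⁺ʳ; ∈-++⁻; ∈-map⁺; ∈-map⁻; ∈-filter⁺; ∈-filter⁻; ∈-∃++)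
open import Data.List.Properties using (length-++)
open import Data.List.Relation.Binary.Subset.Propositional using (_⊆_)
open import Data.List.Relation.Unary.All as All using (All; []; _∷_; all?)
open import Data.List.Relation.Unary.AllPairs using ([]; _∷_)
open import Data.List.Relation.Unary.Any using (here; there)
open import Data.List.Relation.Unary.Unique.Propositional using (Unique)
open import Data.Nat.Base using (ℕ; suc; _+_; _≤_; z≤n; s≤s)
open import Data.Nat.GCD using (gcd)
open import Data.Nat.Properties using (_≟_; +-suc; module ≤-Reasoning)
open import Data.Product.Base using (∃-syntax; _×_; _,_; proj₁; proj₂)
open import Data.Sum.Base using (inj₁; inj₂)
open import Function.Base using (id)
open import Relation.Binary.PropositionalEquality.Core using (_≡_; _≢_; refl; sym; cong)
open import Relation.Nullary.Decidable using (yes; no; map′; ¬?)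
open import Relation.Nullary.Negation using (contradiction)
open import Relation.Unary using (Decidable)

-- Finite sets of natural numbers are lists without repetitions, so that the
-- cardinality is the length.

-- The case x = y is allowed.
SumFree : List ℕ → Set
SumFree B = ∀ {x y z} → x ∈ B → y ∈ B → z ∈ B → x + y ≢ z

sumFree? : Decidable SumFree
sumFree? B = map′
  (λ h x∈B y∈B z∈B x+y≡z → All.lookup (All.lookup (All.lookup h x∈B) y∈B) z∈B x+y≡z)
  (λ h → All.tabulate λ x∈B → All.tabulate λ y∈B → All.tabulate λ z∈B → h x∈B y∈B z∈B)
  (all? (λ x → all? (λ y → all? (λ z → ¬? (x + y ≟ z)) B) B) B)

-- gcd 0 m = m, so the initial value 0 does not affect nonempty lists;
-- the empty list gets 0.
gcdAll : List ℕ → ℕ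
gcdAll = foldr gcd 0

sublists : List ℕ → List (List ℕ)
sublists []       = [] ∷ []
sublists (x ∷ xs) = sublists xs ++ map (x ∷_) (sublists xs)

-- For A without repetitions, the sublists of A represent each subset of A
-- exactly once. The default 0 is attained, [] being a sum-free sublist;
-- see s-attained and s-maximal.
s : List ℕ → ℕ
s A = max 0 (map length (filter sumFree? (sublists A)))

SumFreeSubset : List ℕ → List ℕ → Set
SumFreeSubset B A = Unique B × B ⊆ A × SumFree B

private
  sublists-⊆ : ∀ A {B} → B ∈ sublists A → B ⊆ A
  sublists-⊆ []      (here refl) ()
  sublists-⊆ (a ∷ A) B∈ x∈B with ∈-++⁻ (sublists A) B∈
  ... | inj₁ B∈′ = there (sublists-⊆ A B∈′ x∈B)
  ... | inj₂ B∈′ with ∈-map⁻ (a ∷_) B∈′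
  ...   | C , C∈ , refl with x∈B
  ...     | here x≡a  = here x≡a
  ...     | there x∈C = there (sublists-⊆ A C∈ x∈C)

  sublists-unique : ∀ {A} → Unique A → ∀ {B} → B ∈ sublists A → Unique B
  sublists-unique {[]}    []         (here refl) = []
  sublists-unique {a ∷ A} (a∉A ∷ !A) B∈ with ∈-++⁻ (sublists A) B∈
  ... | inj₁ B∈′ = sublists-unique !A B∈′
  ... | inj₂ B∈′ with ∈-map⁻ (a ∷_) B∈′
  ...   | C , C∈ , refl =
    All.tabulate (λ x∈C → All.lookup a∉A (sublists-⊆ A C∈ x∈C)) ∷ sublists-unique !A C∈

  filter∈sublists : ∀ {P : ℕ → Set} (P? : Decidable P) A → filter P? A ∈ sublists A
  filter∈sublists P? []      = here refl
  filter∈sublists P? (a ∷ A) with P? a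
  ... | yes _ = ∈-++⁺ʳ (sublists A) (∈-map⁺ (a ∷_) (filter∈sublists P? A))
  ... | no  _ = ∈-++⁺ˡ (filter∈sublists P? A)

  unique-⊆⇒length≤ : ∀ {B C : List ℕ} → Unique B → B ⊆ C → length B ≤ length C
  unique-⊆⇒length≤ {[]}    []         B⊆C = z≤n
  unique-⊆⇒length≤ {b ∷ B} (b∉B ∷ !B) B⊆C with ∈-∃++ (B⊆C (here refl))
  ... | us , vs , refl = begin
    suc (length B)                ≤⟨ s≤s (unique-⊆⇒length≤ !B B⊆us++vs) ⟩
    suc (length (us ++ vs))       ≡⟨ cong suc (length-++ us) ⟩
    suc (length us + length vs)   ≡⟨ +-suc (length us) (length vs) ⟨
    length us + suc (length vs)   ≡⟨ length-++ us ⟨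
    length (us ++ b ∷ vs)         ∎
    where
    open ≤-Reasoning
    B⊆us++vs : B ⊆ us ++ vs
    B⊆us++vs x∈B with ∈-++⁻ us (B⊆C (there x∈B))
    ... | inj₁ x∈us         = ∈-++⁺ˡ x∈us
    ... | inj₂ (here x≡b)   = contradiction (sym x≡b) (All.lookup b∉B x∈B)
    ... | inj₂ (there x∈vs) = ∈-++⁺ʳ us x∈vs

s-attained : ∀ {A} → Unique A → ∃[ B ] SumFreeSubset B A × length B ≡ s A
s-attained {A} !A with argmax-sel id 0 (map length (filter sumFree? (sublists A)))
... | inj₁ s≡0 = [] , ([] , (λ ()) , λ ()) , sym s≡0
... | inj₂ s∈ with ∈-map⁻ length s∈
...   | B , B∈ , s≡∣B∣ with ∈-filter⁻ sumFree? {xs = sublists A} B∈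
...     | B∈sub , free =
  B , (sublists-unique !A B∈sub , sublists-⊆ A B∈sub , free) , sym s≡∣B∣

s-maximal : ∀ {A B} → SumFreeSubset B A → length B ≤ s A
s-maximal {A} {B} (!B , B⊆A , free) =
  v≤max⁺ 0 _ (inj₂ (lose ∣C∣∈ (unique-⊆⇒length≤ !B B⊆C)))
  where
  C : List ℕ
  C = filter (λ x → ∈-dec _≟_ x B) A

  B⊆C : B ⊆ C
  B⊆C x∈B = ∈-filter⁺ (λ x → ∈-dec _≟_ x B) (B⊆A x∈B) x∈B

  C⊆B : C ⊆ B
  C⊆B x∈C = proj₂ (∈-filter⁻ (λ x → ∈-dec _≟_ x B) {xs = A} x∈C)

  ∣C∣∈ : length C ∈ map length (filter sumFree? (sublists A))
  ∣C∣∈ = ∈-map⁺ length (∈-filter⁺ sumFree? (filter∈sublists (λ x → ∈-dec _≟_ x B) A)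
    (λ x∈C y∈C z∈C → free (C⊆B x∈C) (C⊆B y∈C) (C⊆B z∈C)))

{-# OPTIONS --safe #-}
-- For x on the circle, the a ∈ A with a x ∈ [1/3, 2/3) modulo 1 form a sum-free
-- set.  Call A good if some x gives at least (|A| + 2) / 3 such a; we show that
-- every nonempty A is good unless A = {m, 2 m}.  Write A = T ∪ U with T the
-- multiples of 3.  Moving x by 1/3 does not affect T, and over the three translates
-- the counts for U add up to |U|; hence A is good whenever T is, and we may induct
-- on T / 3.  If T is empty and |A| ≥ 3, then x = 1/3 or x = 2/3 works.  There
-- remains T = {m, 2 m}, where T contributes 1 for every x with m x ∈ [1/6, 5/6):
-- it suffices to find such an x where the count for U is not exactly |U| / 3.
-- With M = max U, take x = 1 / (6 m) if M < 2 m; otherwise take x on either side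
-- of some j / (3 M) with j coprime to 3 M, where the count for U jumps.
module Submission where

open import Defs
open import Data.Integer.Base as ℤ using (+_; +≤+)
import Data.Integer.Properties as ℤₚ
open import Data.List.Base using (List; []; _∷_; _++_; length; map; filter)
open import Data.List.Extrema.Nat using (max; xs≤max)
open import Data.List.Membership.Propositional using (_∈_)
open import Data.List.Membership.Propositional.Properties using (∈-filter⁻)
open import Data.List.Properties using (filter-accept; filter-reject; length-++; length-map; map-++)
open import Data.List.Relation.Binary.BagAndSetEquality using (_∼[_]_; set; bag-=⇒; ↭⇒∼bag)
open import Data.List.Relation.Binary.Permutation.Propositional
  using (_↭_; refl; prep; swap; ↭-refl; ↭-sym; ↭-trans; ↭-reflexive)
open import Data.List.Relation.Binary.Permutation.Propositional.Properties
  using (↭-length; map⁺; All-resp-↭; ++⁺ʳ; shift)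
open import Data.List.Relation.Unary.All as All using (All; []; _∷_)
import Data.List.Relation.Unary.All.Properties as All
open import Data.List.Relation.Unary.AllPairs using ([]; _∷_)
open import Data.List.Relation.Unary.Unique.Propositional using (Unique)
import Data.List.Relation.Unary.Unique.Propositional.Properties as Unique
open import Data.Nat.Base hiding (_/_) renaming (_≤_ to _≤ⁿ_)
open import Data.Nat.Coprimality using (Coprime; coprime-divisor) renaming (sym to Coprime-sym)
open import Data.Nat.Divisibility
open import Data.Nat.DivMod hiding (_/_)
import Data.Nat.DivMod as ℕ
open import Data.Nat.GCD using (gcd-greatest)
open import Data.Nat.Induction using (<-rec)
open import Data.Nat.ListAction using (sum)
open import Data.Nat.ListAction.Properties using (sum-++; sum-↭)
open import Data.Nat.Properties
open import Data.Nat.Tactic.RingSolver using (solve-∀)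
open import Data.Product.Base using (∃-syntax; _×_; _,_; proj₁; proj₂)
open import Data.Rational.Base using (_/_; _≤_)
import Data.Rational.Properties as ℚ
open import Data.Rational.Unnormalised.Base as ℚᵘ using (mkℚᵘ)
import Data.Rational.Unnormalised.Properties as ℚᵘ
open import Data.Sum.Base as Sum using (_⊎_; inj₁; inj₂)
open import Function.Base using (_∘_)
open import Relation.Binary.Definitions using (Tri; tri<; tri≈; tri>)
open import Relation.Binary.PropositionalEquality
  using (_≡_; _≢_; refl; sym; trans; cong; cong₂; subst; subst₂; module ≡-Reasoning)
open import Relation.Nullary.Decidable using (Dec; yes; no; ¬?)
open import Relation.Nullary.Negation using (¬_; contradiction)
open import Relation.Unary using (Decidable)

private variable
  A T U : List ℕ

-- Division, residues modulo 3 and parity.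

/-unique : ∀ {n r k d} .{{_ : NonZero d}} → n ≡ r + k * d → r < d → n ℕ./ d ≡ k
/-unique {r = r} {k} {d} refl r<d = begin
  (r + k * d) ℕ./ d         ≡⟨ +-distrib-/-∣ʳ r (n∣m*n k) ⟩
  r ℕ./ d + (k * d) ℕ./ d   ≡⟨ cong₂ _+_ (m<n⇒m/n≡0 r<d) (m*n/n≡m k d) ⟩
  k                         ∎
  where open ≡-Reasoning

3∤-view : ∀ {a} → ¬ 3 ∣ a → ∃[ k ] (a ≡ k * 3 + 1 ⊎ a ≡ k * 3 + 2)
3∤-view {0}                 3∤a = contradiction (3 ∣0) 3∤a
3∤-view {1}                 3∤a = 0 , inj₁ refl
3∤-view {2}                 3∤a = 0 , inj₂ refl
3∤-view {suc (suc (suc a))} 3∤a with 3∤-view (3∤a ∘ ∣m∣n⇒∣m+n ∣-refl)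
... | k , inj₁ refl = suc k , inj₁ refl
... | k , inj₂ refl = suc k , inj₂ refl

halve : ∀ n → ∃[ k ] (n ≡ 2 * k ⊎ n ≡ suc (2 * k))
halve zero    = 0 , inj₁ refl
halve (suc n) with halve n
... | k , inj₁ refl = k , inj₂ refl
... | k , inj₂ refl = suc k , inj₁ (eq k)
  where
  eq : ∀ k → suc (suc (2 * k)) ≡ 2 * suc k
  eq = solve-∀

-- Points of the circle and counts in the middle third.

-- The point p ÷ q stands for x = p / (3q) on the circle, so that a x lies in
-- [1/3, 2/3) modulo 1 exactly when index (p ÷ q) a ≡ 1 modulo 3.
infix 5 _÷_
record Point : Set where
  constructor _÷_
  field
    num den     : ℕ
    .{{den≢0}} : NonZero den

index : Point → ℕ → ℕ
index (p ÷ q) a = (a * p) ℕ./ q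

middle : ℕ → ℕ
middle 0                   = 0
middle 1                   = 1
middle 2                   = 0
middle (suc (suc (suc n))) = middle n

hit : Point → ℕ → ℕ
hit X a = middle (index X a)

hits : Point → List ℕ → ℕ
hits X A = sum (map (hit X) A)

Good : List ℕ → Set
Good A = ∃[ X ] length A + 2 ≤ⁿ 3 * hits X A

hits-++ : ∀ X T U → hits X (T ++ U) ≡ hits X T + hits X U
hits-++ X T U = trans (cong sum (map-++ (hit X) T U)) (sum-++ (map (hit X) T) _)

Good-resp-↭ : T ↭ U → Good T → Good U
Good-resp-↭ T↭U (X , good) rewrite ↭-length T↭U | sum-↭ (map⁺ (hit X) T↭U) = X , good

-- Averaging over translates by 1/3.

middle-periodic : ∀ k n → middle (k * 3 + n) ≡ middle n
middle-periodic zero    n = refl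
middle-periodic (suc k) n = middle-periodic k n

-- As `a` is invertible modulo 3, the numbers n, n + a, n + 2 a run through all residues, and only
-- residue 1 counts.
middle-average : ∀ {a} n → ¬ 3 ∣ a → middle n + middle (n + a) + middle (n + a + a) ≡ 1
middle-average n 3∤a with 3∤-view 3∤a
... | k , inj₁ refl = begin
  middle n + middle (n + (k * 3 + 1)) + middle (n + (k * 3 + 1) + (k * 3 + 1))
    ≡⟨ cong₂ (λ u v → middle n + middle u + middle v) (eq₁ k n) (eq₂ k n) ⟩
  middle n + middle (k * 3 + (n + 1)) + middle ((k + k) * 3 + (n + 2))
    ≡⟨ cong₂ (λ u v → middle n + u + v) (middle-periodic k _) (middle-periodic (k + k) _) ⟩
  middle n + middle (n + 1) + middle (n + 2)
    ≡⟨ consecutive n ⟩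
  1 ∎
  where
  open ≡-Reasoning
  eq₁ : ∀ k n → n + (k * 3 + 1) ≡ k * 3 + (n + 1)
  eq₁ = solve-∀
  eq₂ : ∀ k n → n + (k * 3 + 1) + (k * 3 + 1) ≡ (k + k) * 3 + (n + 2)
  eq₂ = solve-∀
  consecutive : ∀ n → middle n + middle (n + 1) + middle (n + 2) ≡ 1
  consecutive 0                   = refl
  consecutive 1                   = refl
  consecutive 2                   = refl
  consecutive (suc (suc (suc n))) = consecutive n
... | k , inj₂ refl = begin
  middle n + middle (n + (k * 3 + 2)) + middle (n + (k * 3 + 2) + (k * 3 + 2))
    ≡⟨ cong₂ (λ u v → middle n + middle u + middle v) (eq₁ k n) (eq₂ k n) ⟩
  middle n + middle (k * 3 + (n + 2)) + middle ((k + k) * 3 + (n + 4))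
    ≡⟨ cong₂ (λ u v → middle n + u + v) (middle-periodic k _) (middle-periodic (k + k) _) ⟩
  middle n + middle (n + 2) + middle (n + 4)
    ≡⟨ alternate n ⟩
  1 ∎
  where
  open ≡-Reasoning
  eq₁ : ∀ k n → n + (k * 3 + 2) ≡ k * 3 + (n + 2)
  eq₁ = solve-∀
  eq₂ : ∀ k n → n + (k * 3 + 2) + (k * 3 + 2) ≡ (k + k) * 3 + (n + 4)
  eq₂ = solve-∀
  alternate : ∀ n → middle n + middle (n + 2) + middle (n + 4) ≡ 1
  alternate 0                   = refl
  alternate 1                   = refl
  alternate 2                   = refl
  alternate (suc (suc (suc n))) = alternate n

-- Translation of x by 1/3.
rotate : Point → Point
rotate (p ÷ q) = (p + q) ÷ q

index-rotate : ∀ X a → index (rotate X) a ≡ index X a + a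
index-rotate (p ÷ q) a = begin
  (a * (p + q)) ℕ./ q             ≡⟨ /-congˡ (*-distribˡ-+ a p q) ⟩
  (a * p + a * q) ℕ./ q           ≡⟨ +-distrib-/-∣ʳ (a * p) (n∣m*n a) ⟩
  (a * p) ℕ./ q + (a * q) ℕ./ q   ≡⟨ cong (_+_ ((a * p) ℕ./ q)) (m*n/n≡m a q) ⟩
  (a * p) ℕ./ q + a               ∎
  where open ≡-Reasoning

hit-rotate-3* : ∀ X a → hit (rotate X) (3 * a) ≡ hit X (3 * a)
hit-rotate-3* X a = begin
  middle (index (rotate X) (3 * a))   ≡⟨ cong middle (index-rotate X (3 * a)) ⟩
  middle (index X (3 * a) + 3 * a)    ≡⟨ cong middle (eq (index X (3 * a)) a) ⟩
  middle (a * 3 + index X (3 * a))    ≡⟨ middle-periodic a _ ⟩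
  middle (index X (3 * a))            ∎
  where
  open ≡-Reasoning
  eq : ∀ n a → n + 3 * a ≡ a * 3 + n
  eq = solve-∀

hits-average : ∀ X → All (λ a → ¬ 3 ∣ a) U →
  hits X U + hits (rotate X) U + hits (rotate (rotate X)) U ≡ length U
hits-average X []                      = refl
hits-average {a ∷ U} X (3∤a ∷ 3∤U) = begin
  (h₀ + t₀) + (h₁ + t₁) + (h₂ + t₂)   ≡⟨ eq h₀ t₀ h₁ t₁ h₂ t₂ ⟩
  (h₀ + h₁ + h₂) + (t₀ + t₁ + t₂)     ≡⟨ cong₂ _+_ at-a (hits-average X 3∤U) ⟩
  1 + length U                        ∎
  where
  open ≡-Reasoning
  X′ = rotate X
  X″ = rotate X′
  h₀ = hit X a
  h₁ = hit X′ a
  h₂ = hit X″ a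
  t₀ = hits X U
  t₁ = hits X′ U
  t₂ = hits X″ U
  eq : ∀ a b c d e f → (a + b) + (c + d) + (e + f) ≡ (a + c + e) + (b + d + f)
  eq = solve-∀
  index″ : index X″ a ≡ index X a + a + a
  index″ = trans (index-rotate X′ a) (cong (_+ a) (index-rotate X a))
  at-a : h₀ + h₁ + h₂ ≡ 1
  at-a = begin
    h₀ + h₁ + h₂ ≡⟨ cong₂ (λ u v → h₀ + middle u + middle v) (index-rotate X a) index″ ⟩
    _            ≡⟨ middle-average (index X a) 3∤a ⟩
    1            ∎

above-average : ∀ x y z → 3 * x ≢ x + y + z →
  x + y + z < 3 * x ⊎ x + y + z < 3 * y ⊎ x + y + z < 3 * z
above-average x y z x≢ with x + y + z <? 3 * x | x + y + z <? 3 * y | x + y + z <? 3 * z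
... | yes x> | _      | _      = inj₁ x>
... | no  _  | yes y> | _      = inj₂ (inj₁ y>)
... | no  _  | no  _  | yes z> = inj₂ (inj₂ z>)
... | no  x≯ | no  y≯ | no  z≯ = contradiction
  (+-mono-<-≤ (+-mono-<-≤ (≤∧≢⇒< (≮⇒≥ x≯) x≢) (≮⇒≥ y≯)) (≮⇒≥ z≯))
  (≤⇒≯ (≤-reflexive (eq x y z)))
  where
  eq : ∀ x y z → (x + y + z) + (x + y + z) + (x + y + z) ≡ 3 * x + 3 * y + 3 * z
  eq = solve-∀

-- If one translate misses the average, some translate exceeds it, and translation by 1/3 leaves the
-- multiples of 3 alone. So an unbalanced U yields a strict surplus at no cost elsewhere.
rebalance : ∀ X → All (λ a → ¬ 3 ∣ a) U → 3 * hits X U ≢ length U →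
  ∃[ Y ] (∀ a → hit Y (3 * a) ≡ hit X (3 * a)) × length U < 3 * hits Y U
rebalance {U} X 3∤U unbalanced
  with above-average (hits X U) (hits (rotate X) U) (hits (rotate (rotate X)) U)
         (unbalanced ∘ λ eq → trans eq (hits-average X 3∤U))
... | inj₁ x>        rewrite hits-average X 3∤U = X , (λ _ → refl) , x>
... | inj₂ (inj₁ y>) rewrite hits-average X 3∤U = rotate X , hit-rotate-3* X , y>
... | inj₂ (inj₂ z>) rewrite hits-average X 3∤U = rotate (rotate X) ,
  (λ a → trans (hit-rotate-3* (rotate X) a) (hit-rotate-3* X a)) , z>

-- Lifting from T / 3, and the base cases.

-- At x / 3 the element 3 a sits where a sits at x. Among the translates of x / 3 by thirds, which
-- agree on multiples of 3, one hits at least a third of U; the surplus 2 comes from T.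
Good-3* : Good T → All (λ a → ¬ 3 ∣ a) U → Good (map (3 *_) T ++ U)
Good-3* {T} {U} (p ÷ q , good) 3∤U = Y , (begin
  length (T₃ ++ U) + 2          ≡⟨ cong (_+ 2) (length-++ T₃) ⟩
  length T₃ + length U + 2      ≡⟨ cong (λ n → n + length U + 2) (length-map _ T) ⟩
  length T + length U + 2       ≡⟨ eq (length T) (length U) ⟩
  (length T + 2) + length U     ≤⟨ +-mono-≤ good (proj₂ (proj₂ chosen)) ⟩
  3 * hits X T + 3 * hits Y U   ≡⟨ *-distribˡ-+ 3 (hits X T) (hits Y U) ⟨
  3 * (hits X T + hits Y U)     ≡⟨ cong (λ h → 3 * (h + hits Y U)) hits-T ⟨
  3 * (hits Y T₃ + hits Y U)    ≡⟨ cong (3 *_) (hits-++ Y T₃ U) ⟨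
  3 * hits Y (T₃ ++ U)          ∎)
  where
  open ≤-Reasoning
  X = p ÷ q
  T₃ = map (3 *_) T
  instance
    3q≢0 : NonZero (3 * q)
    3q≢0 = m*n≢0 3 q
  X₃ = p ÷ (3 * q)
  choose : ∃[ Y ] (∀ a → hit Y (3 * a) ≡ hit X₃ (3 * a)) × length U ≤ⁿ 3 * hits Y U
  choose with 3 * hits X₃ U ≟ length U
  ... | yes balanced = X₃ , (λ _ → refl) , ≤-reflexive (sym balanced)
  ... | no unbalanced with rebalance X₃ 3∤U unbalanced
  ...   | Y , same , more = Y , same , <⇒≤ more
  chosen = choose
  Y = proj₁ chosen
  hit-3* : ∀ a → hit Y (3 * a) ≡ hit X a
  hit-3* a = trans (proj₁ (proj₂ chosen) a) (cong middle
    (trans (/-congˡ {o = 3 * q} (*-assoc 3 a p)) (m*n/m*o≡n/o 3 (a * p) q)))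
  hits-T : hits Y T₃ ≡ hits X T
  hits-T = go T
    where
    go : ∀ T → hits Y (map (3 *_) T) ≡ hits X T
    go []      = refl
    go (a ∷ T) = cong₂ _+_ (hit-3* a) (go T)
  eq : ∀ t u → t + u + 2 ≡ (t + 2) + u
  eq = solve-∀

hits-0÷1 : ∀ U → hits (0 ÷ 1) U ≡ 0
hits-0÷1 []      = refl
hits-0÷1 (a ∷ U) rewrite *-zeroʳ a = hits-0÷1 U

-- The points 0, 1/3 and 2/3 of the circle.
Good-3∤ : All (λ a → ¬ 3 ∣ a) U → 3 ≤ⁿ length U → Good U
Good-3∤ {U} 3∤U 3≤n with length U + 2 ≤? 3 * hits (1 ÷ 1) U | length U + 2 ≤? 3 * hits (2 ÷ 1) U
... | yes good | _        = 1 ÷ 1 , good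
... | no  _    | yes good = 2 ÷ 1 , good
-- At 0 nothing is hit, so 1/3 and 2/3 share all n elements; if both failed, then 3 n ≤ 2 (n + 1)
-- and n ≤ 2.
... | no ¬g₁   | no ¬g₂   = contradiction 3≤n (<⇒≱ (s≤s (+-cancelˡ-≤ (2 * n) n 2 (begin
  2 * n + n              ≡⟨ eq₁ n ⟩
  3 * n                  ≡⟨ cong (3 *_) average ⟨
  3 * (h₁ + h₂)          ≡⟨ *-distribˡ-+ 3 h₁ h₂ ⟩
  3 * h₁ + 3 * h₂        ≤⟨ +-mono-≤ (below ¬g₁) (below ¬g₂) ⟩
  (n + 1) + (n + 1)      ≡⟨ eq₂ n ⟩
  2 * n + 2              ∎))))
  where
  open ≤-Reasoning
  n = length U
  h₁ = hits (1 ÷ 1) U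
  h₂ = hits (2 ÷ 1) U
  average : h₁ + h₂ ≡ n
  average = trans (cong (λ h → h + h₁ + h₂) (sym (hits-0÷1 U))) (hits-average (0 ÷ 1) 3∤U)
  below : ∀ {h} → ¬ n + 2 ≤ⁿ h → h ≤ⁿ n + 1
  below {h} ¬g = s≤s⁻¹ (subst (h <_) (+-suc n 1) (≰⇒> ¬g))
  eq₁ : ∀ n → 2 * n + n ≡ 3 * n
  eq₁ = solve-∀
  eq₂ : ∀ n → (n + 1) + (n + 1) ≡ 2 * n + 2
  eq₂ = solve-∀

-- With k = a + b the residues of i a and i b modulo k are opposite, so that one
-- of them is in the middle third exactly when the other is.
Good-pair : ∀ {a b} → 0 < a → a < b → b ≢ 2 * a → Good (a ∷ b ∷ [])
Good-pair {a} {b} 0<a a<b b≢2a = 3 * suc i ÷ k , (begin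
  4                                                              ≤⟨ m≤m+n 4 2 ⟩
  6                                                              ≡⟨ cong₂ (λ u v → 3 * (u + (v + 0))) hit-a hit-b ⟨
  3 * hits (3 * suc i ÷ k) (a ∷ b ∷ [])                          ∎)
  where
  open ≤-Reasoning
  k = a + b
  instance
    k≢0 : NonZero k
    k≢0 = >-nonZero (<-≤-trans 0<a (m≤m+n a b))
    3a≢0 : NonZero (3 * a)
    3a≢0 = >-nonZero (<-≤-trans 0<a (m≤m+n a _))
  -- The number 3 a (i + 1) is the least multiple of 3 a above k, and `r` is its excess over k.
  -- Hence a x = (1 + r / k) / 3 at x = (i + 1) / k.
  i = k ℕ./ (3 * a)
  ρ = k % (3 * a)
  k≡ : k ≡ ρ + i * (3 * a)
  k≡ = m≡m%n+[m/n]*n k (3 * a)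
  ρ< : ρ < 3 * a
  ρ< = m%n<n k (3 * a)
  r = 3 * a ∸ ρ
  ρ+r : ρ + r ≡ 3 * a
  ρ+r = m+[n∸m]≡n (<⇒≤ ρ<)
  r<k : r < k
  r<k with <-cmp (3 * a) k
  ... | tri< 3a<k _ _ = ≤-<-trans (m∸n≤m (3 * a) ρ) 3a<k
  ... | tri≈ _ 3a≡k _ = contradiction (sym (+-cancelˡ-≡ a (2 * a) b 3a≡k)) b≢2a
  -- Here i = 0 and ρ = k, so r = 3 a - k, which is below k because 3 a < 2 k.
  ... | tri> _ _ k<3a = +-cancelˡ-< k r k (begin-strict
    k + r              ≡⟨ cong (_+ r) (m<n⇒m%n≡m k<3a) ⟨
    ρ + r              ≡⟨ ρ+r ⟩
    3 * a              ≡⟨ eq a ⟩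
    (a + a) + (a + 0)  <⟨ +-mono-<-≤ (+-monoʳ-< a a<b) (+-monoʳ-≤ a z≤n) ⟩
    k + k              ∎)
    where
    eq : ∀ a → 3 * a ≡ (a + a) + (a + 0)
    eq = solve-∀
  t = k ∸ r
  r+t : r + t ≡ k
  r+t = m+[n∸m]≡n (<⇒≤ r<k)
  t<k : t < k
  t<k = ∸-monoʳ-< (m<n⇒0<n∸m ρ<) (<⇒≤ r<k)
  a-multiple : a * (3 * suc i) ≡ r + 1 * k
  a-multiple = begin-equality
    a * (3 * suc i)             ≡⟨ eq a i ⟩
    i * (3 * a) + 3 * a         ≡⟨ cong (_+_ (i * (3 * a))) ρ+r ⟨
    i * (3 * a) + (ρ + r)       ≡⟨ eq′ (i * (3 * a)) ρ r ⟩
    r + 1 * (ρ + i * (3 * a))   ≡⟨ cong (λ n → r + 1 * n) k≡ ⟨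
    r + 1 * k                   ∎
    where
    eq : ∀ a i → a * (3 * suc i) ≡ i * (3 * a) + 3 * a
    eq = solve-∀
    eq′ : ∀ x ρ r → x + (ρ + r) ≡ r + 1 * (ρ + x)
    eq′ = solve-∀
  b-multiple : b * (3 * suc i) ≡ t + (i * 3 + 1) * k
  b-multiple = +-cancelˡ-≡ (r + 1 * k) _ _ (begin-equality
    (r + 1 * k) + b * (3 * suc i)            ≡⟨ cong (_+ b * (3 * suc i)) a-multiple ⟨
    a * (3 * suc i) + b * (3 * suc i)        ≡⟨ eq a b i ⟩
    k + (i * 3 + 2) * k                      ≡⟨ cong (_+ (i * 3 + 2) * k) r+t ⟨
    (r + t) + (i * 3 + 2) * k               ≡⟨ eq′ r t i k ⟩
    (r + 1 * k) + (t + (i * 3 + 1) * k)     ∎)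
    where
    eq : ∀ a b i → a * (3 * suc i) + b * (3 * suc i) ≡ (a + b) + (i * 3 + 2) * (a + b)
    eq = solve-∀
    eq′ : ∀ r t i k → (r + t) + (i * 3 + 2) * k ≡ (r + 1 * k) + (t + (i * 3 + 1) * k)
    eq′ = solve-∀
  hit-a : hit (3 * suc i ÷ k) a ≡ 1
  hit-a = cong middle (/-unique {k = 1} a-multiple r<k)
  hit-b : hit (3 * suc i ÷ k) b ≡ 1
  hit-b = trans (cong middle (/-unique {k = i * 3 + 1} b-multiple t<k)) (middle-periodic i 1)

-- Multipliers coprime to M.

odd⇒coprime-2 : ∀ {n} → ¬ 2 ∣ n → Coprime n 2
odd⇒coprime-2 2∤n {0} (_ , 0∣2) = contradiction (0∣⇒≡0 0∣2) λ ()
odd⇒coprime-2 2∤n {1} _ = refl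
odd⇒coprime-2 2∤n {2} (2∣n , _) = contradiction 2∣n 2∤n
odd⇒coprime-2 2∤n {suc (suc (suc d))} (_ , d∣2) =
  contradiction (∣⇒≤ d∣2) λ { (s≤s (s≤s ())) }

coprime-* : ∀ {k m n} → Coprime k m → Coprime k n → Coprime k (m * n)
coprime-* k⊥m k⊥n (d∣k , d∣mn) =
  k⊥n (d∣k , coprime-divisor (λ (e∣d , e∣m) → k⊥m (∣-trans e∣d d∣k , e∣m)) d∣mn)

∣m+n∣n⇒∣m : ∀ {d} m n → d ∣ m + n → d ∣ n → d ∣ m
∣m+n∣n⇒∣m {d} m n d∣m+n = ∣m+n∣m⇒∣n (subst (d ∣_) (+-comm m n) d∣m+n)

2∤1+2* : ∀ k → ¬ 2 ∣ suc (2 * k)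
2∤1+2* k (divides q eq) = even≢odd q k (trans (*-comm 2 q) (sym eq))

-- A multiplier j coprime to M which moves l / M into [1/6, 5/6) modulo 1.
record Unit (l M : ℕ) : Set where
  constructor unit
  field
    {j r k} : ℕ
    lj≡     : l * j ≡ r + k * M
    M≤6r    : M ≤ⁿ 6 * r
    6r<5M   : 6 * r < 5 * M
    M⊥j     : Coprime M j

-- Powers of 2 are coprime to the odd M, and the first one that takes l to M / 6 or beyond still
-- leaves it below M / 3.
odd-Unit : ∀ {M} l → ¬ 2 ∣ M → 0 < l → 6 * l < M → Unit l M
odd-Unit {M} l 2∤M = go M 1 l (*-identityʳ l) (∣1⇒≡1 ∘ proj₂) (m≤m+n M l)
  where
  open ≤-Reasoning
  -- Each doubling raises r by at least 1, so M ≤ fuel + r persists; once `fuel` is zero this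
  -- contradicts 6 r < M.
  go : ∀ fuel j r → l * j ≡ r → Coprime M j → M ≤ⁿ fuel + r → 0 < r → 6 * r < M → Unit l M
  go zero       j r lj≡r M⊥j M≤r 0<r 6r<M =
    contradiction (≤-<-trans (m≤m+n r _) 6r<M) (≤⇒≯ M≤r)
  go (suc fuel) j r lj≡r M⊥j M≤  0<r 6r<M with M ≤? 6 * (2 * r)
  ... | yes M≤12r = unit {r = 2 * r} {0} double M≤12r (begin-strict
    6 * (2 * r)   ≡⟨ eq r ⟩
    2 * (6 * r)   <⟨ *-monoʳ-< 2 6r<M ⟩
    2 * M         ≤⟨ *-monoˡ-≤ M {2} {5} (s≤s (s≤s z≤n)) ⟩
    5 * M         ∎) (coprime-* (λ (d∣M , d∣2) → odd⇒coprime-2 2∤M (d∣M , d∣2)) M⊥j)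
    where
    eq : ∀ r → 6 * (2 * r) ≡ 2 * (6 * r)
    eq = solve-∀
    eq′ : ∀ l j → l * (2 * j) ≡ 2 * (l * j) + 0
    eq′ = solve-∀
    double : l * (2 * j) ≡ 2 * r + 0 * M
    double = trans (eq′ l j) (cong (λ n → 2 * n + 0) lj≡r)
  ... | no  M≰12r = go fuel (2 * j) (2 * r)
    (trans (eq l j) (cong (2 *_) lj≡r))
    (coprime-* (odd⇒coprime-2 2∤M) M⊥j)
    (begin
      M                 ≤⟨ M≤ ⟩
      suc fuel + r      ≡⟨ +-suc fuel r ⟨
      fuel + suc r      ≤⟨ +-monoʳ-≤ fuel (+-mono-≤ 0<r (m≤m+n r 0)) ⟩
      fuel + 2 * r      ∎)
    (<-≤-trans 0<r (m≤m+n r _))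
    (≰⇒> M≰12r)
    where
    eq : ∀ l j → l * (2 * j) ≡ 2 * (l * j)
    eq = solve-∀

-- The fractions e j / K and (2 e) j / (2 K) are equal, so j only has to be made odd.
double-Unit : ∀ {e K} → Unit e K → Unit (2 * e) (2 * K)
double-Unit {e} {K} (unit {j} {r} {k} ej≡ K≤6r 6r<5K K⊥j) = go (2 ∣? j)
  where
  open ≤-Reasoning
  eq₁ : ∀ r k K → 2 * (r + k * K) ≡ 2 * r + k * (2 * K)
  eq₁ = solve-∀
  eq₂ : ∀ n r → 2 * (n * r) ≡ n * (2 * r)
  eq₂ = solve-∀
  eq₃ : ∀ e K r k → e * K + (r + k * K) ≡ r + (e + k) * K
  eq₃ = solve-∀
  scale : ∀ j k → e * j ≡ r + k * K → ¬ 2 ∣ j → Coprime K j → Unit (2 * e) (2 * K)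
  scale j k ej≡ 2∤j K⊥j = unit {r = 2 * r} {k}
    (begin-equality
      (2 * e) * j            ≡⟨ *-assoc 2 e j ⟩
      2 * (e * j)            ≡⟨ cong (2 *_) ej≡ ⟩
      2 * (r + k * K)        ≡⟨ eq₁ r k K ⟩
      2 * r + k * (2 * K)    ∎)
    (begin
      2 * K                  ≤⟨ *-monoʳ-≤ 2 K≤6r ⟩
      2 * (6 * r)            ≡⟨ eq₂ 6 r ⟩
      6 * (2 * r)            ∎)
    (begin-strict
      6 * (2 * r)            ≡⟨ eq₂ 6 r ⟨
      2 * (6 * r)            <⟨ *-monoʳ-< 2 6r<5K ⟩
      2 * (5 * K)            ≡⟨ eq₂ 5 K ⟩
      5 * (2 * K)            ∎)
    (Coprime-sym (coprime-* (odd⇒coprime-2 2∤j) (Coprime-sym K⊥j)))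
  go : Dec (2 ∣ j) → Unit (2 * e) (2 * K)
  go (no 2∤j)  = scale j k ej≡ 2∤j K⊥j
  -- An even j forces K to be odd; then K + j is odd, and e (K + j) has the same residue modulo K.
  go (yes 2∣j) = scale (K + j) (e + k)
    (begin-equality
      e * (K + j)          ≡⟨ *-distribˡ-+ e K j ⟩
      e * K + e * j        ≡⟨ cong (_+_ (e * K)) ej≡ ⟩
      e * K + (r + k * K)  ≡⟨ eq₃ e K r k ⟩
      r + (e + k) * K      ∎)
    (λ 2∣K+j → contradiction (K⊥j (∣m+n∣n⇒∣m K j 2∣K+j 2∣j , 2∣j)) λ ())
    (λ (d∣K , d∣K+j) → K⊥j (d∣K , ∣m+n∣m⇒∣n d∣K+j d∣K))

-- For odd l and even M, the point l (M / 2 + c) / M is close to 1/2 modulo 1.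
odd-even-Unit : ∀ e K → 6 * suc (2 * e) < 2 * K → Unit (suc (2 * e)) (2 * K)
odd-even-Unit e K 6l<2K = go (2 ∣? K)
  where
  open ≤-Reasoning
  l = suc (2 * e)
  -- Since l is odd, l (K + c) / (2 K) is 1/2 + l c / (2 K) modulo 1; from 6 l < 2 K and c ≤ 2 the
  -- second term is below 1/3.
  near-half : ∀ c → c ≤ⁿ 2 → ¬ 2 ∣ K + c → Coprime (K + c) K → Unit l (2 * K)
  near-half c c≤2 2∤K+c K+c⊥K = unit {r = K + l * c} {e}
    (eq₁ e K c)
    (begin
      2 * K              ≤⟨ *-monoˡ-≤ K {2} {6} (s≤s (s≤s z≤n)) ⟩
      6 * K              ≤⟨ *-monoʳ-≤ 6 (m≤m+n K (l * c)) ⟩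
      6 * (K + l * c)    ∎)
    (begin-strict
      6 * (K + l * c)         ≡⟨ eq₂ K l c ⟩
      6 * K + (6 * l) * c     ≤⟨ +-monoʳ-≤ (6 * K) (*-monoʳ-≤ (6 * l) c≤2) ⟩
      6 * K + (6 * l) * 2     <⟨ +-monoʳ-< (6 * K) (*-monoˡ-< 2 6l<2K) ⟩
      6 * K + (2 * K) * 2     ≡⟨ eq₃ K ⟩
      5 * (2 * K)             ∎)
    (Coprime-sym (coprime-* (odd⇒coprime-2 2∤K+c) K+c⊥K))
    where
    eq₁ : ∀ e K c → suc (2 * e) * (K + c) ≡ (K + suc (2 * e) * c) + e * (2 * K)
    eq₁ = solve-∀
    eq₂ : ∀ K l c → 6 * (K + l * c) ≡ 6 * K + (6 * l) * c
    eq₂ = solve-∀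
    eq₃ : ∀ K → 6 * K + (2 * K) * 2 ≡ 5 * (2 * K)
    eq₃ = solve-∀
  go : Dec (2 ∣ K) → Unit l (2 * K)
  -- The shift c is chosen to make K + c odd; a common divisor of K + c and K divides c.
  go (yes 2∣K) = near-half 1 (s≤s z≤n)
    (λ 2∣K+1 → contradiction (∣1⇒≡1 {2} (∣m+n∣m⇒∣n 2∣K+1 2∣K)) λ ())
    (λ (d∣K+1 , d∣K) → ∣1⇒≡1 (∣m+n∣m⇒∣n d∣K+1 d∣K))
  go (no 2∤K) = near-half 2 ≤-refl 2∤K+2
    (λ (d∣K+2 , d∣K) → odd⇒coprime-2 2∤K+2 (d∣K+2 , ∣m+n∣m⇒∣n d∣K+2 d∣K))
    where
    2∤K+2 : ¬ 2 ∣ K + 2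
    2∤K+2 2∣K+2 = 2∤K (∣m+n∣n⇒∣m K 2 2∣K+2 ∣-refl)

-- Common factors 2 of l and M are removed one at a time; the cases of odd M and of odd l with even
-- M are settled directly.
Unit-exists : ∀ l M → 0 < l → 6 * l < M → Unit l M
Unit-exists = <-rec _ step
  where
  step : ∀ l → (∀ {e} → e < l → ∀ M → 0 < e → 6 * e < M → Unit e M) →
         ∀ M → 0 < l → 6 * l < M → Unit l M
  step l rec M 0<l 6l<M with halve M | halve l
  ... | K , inj₂ refl | _             = odd-Unit l (2∤1+2* K) 0<l 6l<M
  ... | K , inj₁ refl | e , inj₂ refl = odd-even-Unit e K 6l<M
  ... | K , inj₁ refl | e , inj₁ refl = double-Unit (rec e<2e K 0<e (*-cancelˡ-< 2 _ _
    (subst (_< 2 * K) (eq e) 6l<M)))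
    where
    0<e : 0 < e
    0<e = *-cancelˡ-< 2 0 e 0<l
    e<2e : e < 2 * e
    e<2e = m<m+n e (<-≤-trans 0<e (m≤m+n e 0))
    eq : ∀ e → 6 * (2 * e) ≡ 2 * (6 * e)
    eq = solve-∀

-- Replacing j by j + M preserves everything except the residue of j modulo 3.
Unit-3∤ : ∀ {l M} → ¬ 3 ∣ M → Unit l M → ∃[ u ] ¬ 3 ∣ Unit.j {l} {M} u
Unit-3∤ {l} {M} 3∤M u@(unit {j} {r} {k} lj≡ M≤6r 6r<5M M⊥j) with 3 ∣? j
... | no  3∤j = u , 3∤j
... | yes 3∣j = unit {j = j + M} {r} {k + l}
  (trans (*-distribˡ-+ l j M) (trans (cong (_+ l * M) lj≡) (eq r k M l))) M≤6r 6r<5M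
  (λ (d∣M , d∣j+M) → M⊥j (d∣M , ∣m+n∣n⇒∣m j M d∣j+M d∣M)) ,
  λ 3∣j+M → 3∤M (∣m+n∣m⇒∣n 3∣j+M 3∣j)
  where
  eq : ∀ r k M l → r + k * M + l * M ≡ r + (k + l) * M
  eq = solve-∀

-- The jump of the index of M.

-- The interval ((j M - 1) / M², j / M] contains a multiple of 1 / M but, for j
-- coprime to M, no multiple of 1 / a with a < M, so only the index of M jumps.
module _ {M j : ℕ} (0<M : 0 < M) (p : ℕ) (p≡ : suc p ≡ suc j * M) where
  private instance
    M≢0 : NonZero M
    M≢0 = >-nonZero 0<M
    M²≢0 : NonZero (M * M)
    M²≢0 = m*n≢0 M M

  index-at : index (suc j ÷ M) M ≡ suc j
  index-at = trans (/-congˡ {o = M} (*-comm M (suc j))) (m*n/n≡m (suc j) M)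

  index-before : index (p ÷ M * M) M ≡ j
  index-before = /-unique {r = M * M ∸ M} (+-cancelʳ-≡ M _ _ (begin
    M * p + M                         ≡⟨ eq₁ M p ⟩
    M * suc p                         ≡⟨ cong (M *_) p≡ ⟩
    M * (suc j * M)                   ≡⟨ eq₂ M j ⟩
    M * M + j * (M * M)               ≡⟨ cong (_+ j * (M * M)) (m∸n+n≡m (m≤m*n M M)) ⟨
    M * M ∸ M + M + j * (M * M)       ≡⟨ eq₃ (M * M ∸ M) M (j * (M * M)) ⟩
    M * M ∸ M + j * (M * M) + M       ∎))
    (∸-monoʳ-< 0<M (m≤m*n M M))
    where
    open ≡-Reasoning
    eq₁ : ∀ M p → M * p + M ≡ M * suc p
    eq₁ = solve-∀
    eq₂ : ∀ M j → M * (suc j * M) ≡ M * M + j * (M * M)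
    eq₂ = solve-∀
    eq₃ : ∀ x y z → x + y + z ≡ x + z + y
    eq₃ = solve-∀

  index-same : Coprime M (suc j) → ∀ {a} → 0 < a → a < M →
               index (p ÷ M * M) a ≡ index (suc j ÷ M) a
  index-same M⊥j {a} 0<a a<M with (a * suc j) % M in r≡ | m≡m%n+[m/n]*n (a * suc j) M | m%n<n (a * suc j) M
  -- By coprimality, residue 0 would make M divide a.
  ... | zero  | _   | _   = contradiction (∣⇒≤ {{>-nonZero 0<a}} M∣a) (<⇒≱ a<M)
    where
    M∣a : M ∣ a
    M∣a = coprime-divisor M⊥j (subst (M ∣_) (*-comm a (suc j)) (m%n≡0⇒n∣m (a * suc j) M r≡))
  -- Passing from `suc j * M` to p costs only a < M, while the residue `suc r` leaves room for M, so
  -- the quotient survives.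
  ... | suc r | aj≡ | r<M = /-unique {r = r * M + (M ∸ a)} (+-cancelʳ-≡ a _ _ (begin
    a * p + a                            ≡⟨ eq₁ a p ⟩
    a * suc p                            ≡⟨ cong (a *_) p≡ ⟩
    a * (suc j * M)                      ≡⟨ *-assoc a (suc j) M ⟨
    a * suc j * M                        ≡⟨ cong (_* M) aj≡ ⟩
    (suc r + k * M) * M                  ≡⟨ eq₂ r k M ⟩
    M + (r * M + k * (M * M))            ≡⟨ cong (_+ (r * M + k * (M * M))) (m∸n+n≡m (<⇒≤ a<M)) ⟨
    (M ∸ a) + a + (r * M + k * (M * M))  ≡⟨ eq₃ (M ∸ a) a (r * M) (k * (M * M)) ⟩
    r * M + (M ∸ a) + k * (M * M) + a    ∎))
    (<-≤-trans (+-monoʳ-< (r * M) (∸-monoʳ-< 0<a (<⇒≤ a<M)))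
      (≤-trans (≤-reflexive (+-comm (r * M) M)) (*-monoˡ-≤ M (<⇒≤ r<M))))
    where
    open ≡-Reasoning
    k = (a * suc j) ℕ./ M
    eq₁ : ∀ a p → a * p + a ≡ a * suc p
    eq₁ = solve-∀
    eq₂ : ∀ r k M → (suc r + k * M) * M ≡ M + (r * M + k * (M * M))
    eq₂ = solve-∀
    eq₃ : ∀ x a y z → x + a + (y + z) ≡ y + x + z + a
    eq₃ = solve-∀

-- Sets whose multiples of 3 are m and 2 m.

extract-max : ∀ a A → Unique (a ∷ A) → ∃[ M ] ∃[ B ] (a ∷ A ↭ M ∷ B) × All (_< M) B
extract-max a []      _          = a , [] , ↭-refl , []
extract-max a (b ∷ A) (a∉ ∷ !A) with extract-max b A !A
... | M , B , p , B<M with <-cmp a M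
...   | tri< a<M _ _ = M , a ∷ B , ↭-trans (prep a p) (swap a M ↭-refl) , a<M ∷ B<M
...   | tri≈ _ a≡M _ = contradiction a≡M (All.head (All-resp-↭ p a∉))
...   | tri> _ _ M<a = a , M ∷ B , prep a p , M<a ∷ All.map (λ b<M → <-trans b<M M<a) B<M

hits-cong : ∀ X Y {U} → All (λ a → index X a ≡ index Y a) U → hits X U ≡ hits Y U
hits-cong X Y []        = refl
hits-cong X Y (eq ∷ eqs) = cong₂ (λ i h → middle i + h) eq (hits-cong X Y eqs)

-- With m = 3 l, the point x satisfies m x ∈ [1/6, 5/6) modulo 1, in which case
-- exactly one of m x and 2 m x lies in [1/3, 2/3).
Central : Point → ℕ → Set
Central X l = ∃[ z ] ∃[ k ] 0 < z × z < 5 × index X (3 * (2 * l)) ≡ z + k * 6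

-- The index of 3 l is half that of 6 l, rounded down. For z = 1, 2, 3, 4 the pairs (z / 2, z) are
-- (0, 1), (1, 2), (1, 3), (2, 4), each with exactly one entry that is 1 modulo 3.
hits-central : ∀ X l → Central X l → hit X (3 * l) + hit X (3 * (2 * l)) ≡ 1
hits-central X@(p ÷ q) l (z , k , 0<z , z<5 , 6l≡) =
  trans (cong₂ (λ u v → middle u + middle v) index-3l 6l≡) (trans middles (cases z 0<z z<5))
  where
  open ≡-Reasoning
  instance
    q2≢0 : NonZero (q * 2)
    q2≢0 = m*n≢0 q 2
  eq : ∀ l p → 3 * l * p * 2 ≡ 3 * (2 * l) * p
  eq = solve-∀
  index-3l : index X (3 * l) ≡ (z + k * 6) ℕ./ 2
  index-3l = begin
    (3 * l * p) ℕ./ q                  ≡⟨ m*n/o*n≡m/o (3 * l * p) 2 q ⟨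
    (3 * l * p * 2) ℕ./ (q * 2)        ≡⟨ /-congˡ {o = q * 2} (eq l p) ⟩
    (3 * (2 * l) * p) ℕ./ (q * 2)      ≡⟨ m/n/o≡m/[n*o] (3 * (2 * l) * p) q 2 ⟨
    (3 * (2 * l) * p) ℕ./ q ℕ./ 2      ≡⟨ cong (ℕ._/ 2) 6l≡ ⟩
    (z + k * 6) ℕ./ 2                  ∎
  half : (z + k * 6) ℕ./ 2 ≡ k * 3 + z ℕ./ 2
  half = begin
    (z + k * 6) ℕ./ 2                  ≡⟨ +-distrib-/-∣ʳ z (∣n⇒∣m*n k (divides 3 refl)) ⟩
    z ℕ./ 2 + k * 6 ℕ./ 2              ≡⟨ cong (λ n → z ℕ./ 2 + n ℕ./ 2) (*-assoc k 3 2) ⟨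
    z ℕ./ 2 + k * 3 * 2 ℕ./ 2          ≡⟨ cong (_+_ (z ℕ./ 2)) (m*n/n≡m (k * 3) 2) ⟩
    z ℕ./ 2 + k * 3                    ≡⟨ +-comm (z ℕ./ 2) (k * 3) ⟩
    k * 3 + z ℕ./ 2                    ∎
  eq′ : ∀ z k → z + k * 6 ≡ (k + k) * 3 + z
  eq′ = solve-∀
  middles : middle ((z + k * 6) ℕ./ 2) + middle (z + k * 6) ≡ middle (z ℕ./ 2) + middle z
  middles = cong₂ _+_
    (trans (cong middle half) (middle-periodic k _))
    (trans (cong middle (eq′ z k)) (middle-periodic (k + k) z))
  cases : ∀ z → 0 < z → z < 5 → middle (z ℕ./ 2) + middle z ≡ 1
  cases 1 _ _ = refl
  cases 2 _ _ = refl
  cases 3 _ _ = refl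
  cases 4 _ _ = refl
  cases (suc (suc (suc (suc (suc _))))) _ (s≤s (s≤s (s≤s (s≤s (s≤s ())))))

-- The pair contributes 1 and a rotated unbalanced U at least (|U| + 1) / 3; together this is the
-- (|U| + 4) / 3 required for |U| + 2 elements.
Good-central : ∀ X l → Central X l → All (λ a → ¬ 3 ∣ a) U → 3 * hits X U ≢ length U →
               Good (3 * l ∷ 3 * (2 * l) ∷ U)
Good-central {U} X l central 3∤U unbalanced with rebalance X 3∤U unbalanced
... | Y , same , more = Y , (begin
  2 + length U + 2                         ≡⟨ eq (length U) ⟩
  3 * 1 + suc (length U)                   ≤⟨ +-monoʳ-≤ 3 more ⟩
  3 * 1 + 3 * h                            ≡⟨ cong (λ n → 3 * n + 3 * h) (hits-central X l central) ⟨
  3 * (hit X (3 * l) + hit X (3 * (2 * l))) + 3 * h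
    ≡⟨ cong₂ (λ u v → 3 * (u + v) + 3 * h) (same l) (same (2 * l)) ⟨
  3 * (u + v) + 3 * h                      ≡⟨ eq′ u v h ⟩
  3 * hits Y (3 * l ∷ 3 * (2 * l) ∷ U)     ∎)
  where
  open ≤-Reasoning
  u = hit Y (3 * l)
  v = hit Y (3 * (2 * l))
  h = hits Y U
  eq : ∀ n → 2 + n + 2 ≡ 3 + suc n
  eq = solve-∀
  eq′ : ∀ u v h → 3 * (u + v) + 3 * h ≡ 3 * (u + (v + h))
  eq′ = solve-∀

-- Residues 0, 1, 2 have values 0, 1, 0, so consecutive values agree only from residue 2 to residue
-- 0.
middle-suc : ∀ j → middle (suc j) ≡ middle j → 3 ∣ suc j
middle-suc 2                   _  = ∣-refl
middle-suc (suc (suc (suc j))) eq = ∣m∣n⇒∣m+n ∣-refl (middle-suc j eq)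

-- At a central point an unbalanced U can be rotated to its advantage. The index of
-- M = max U jumps at j / M without any other index changing, so U is unbalanced on
-- one side of the jump.
Good-double : ∀ {l a V} → 0 < l → let W = a ∷ V in All (λ a → ¬ 3 ∣ a) W → All (0 <_) W →
  Unique W → Good (3 * l ∷ 3 * (2 * l) ∷ W)
Good-double {l} {a} {V} 0<l 3∤W 0<W !W with extract-max a V !W
... | M , B , p , B<M = go (<-cmp M m)
  where
  W = a ∷ V
  m = 3 * (2 * l)
  0<m : 0 < m
  0<m = <-≤-trans 0<l (≤-trans (m≤m+n l _) (m≤m+n (2 * l) _))
  instance
    m≢0 : NonZero m
    m≢0 = >-nonZero 0<m
  0<M : 0 < M
  0<M = All.head (All-resp-↭ p 0<W)
  0<B : All (0 <_) B
  0<B = All.tail (All-resp-↭ p 0<W)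
  3∤M : ¬ 3 ∣ M
  3∤M = All.head (All-resp-↭ p 3∤W)

  small : M < m → Good (3 * l ∷ m ∷ W)
  small M<m = Good-central X l (1 , 0 , s≤s z≤n , s≤s (s≤s z≤n) , index-m) 3∤W
    -- All of W lies below `m`, so every index is 0 and nothing of the nonempty W is hit.
    λ balanced → 0≢1+n (trans (cong (3 *_) (sym no-hits)) balanced)
    where
    X = 1 ÷ m
    index-m : index X m ≡ 1
    index-m = trans (/-congˡ {o = m} (*-identityʳ m)) (n/n≡1 m)
    W<m : All (_< m) W
    W<m = All-resp-↭ (↭-sym p) (M<m ∷ All.map (λ b<M → <-trans b<M M<m) B<M)
    no-hits : hits X W ≡ 0
    no-hits = trans (hits-cong X (0 ÷ 1) (All.map same W<m)) (hits-0÷1 W)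
      where
      same : ∀ {b} → b < m → index X b ≡ index (0 ÷ 1) b
      same {b} b<m = trans (m<n⇒m/n≡0 (subst (_< m) (sym (*-identityʳ b)) b<m))
        (cong (ℕ._/ 1) (sym (*-zeroʳ b)))

  jump : m < M → (u : Unit l M) → ¬ 3 ∣ Unit.j u → Good (3 * l ∷ m ∷ W)
  jump m<M (unit {zero} _ _ _ _) 3∤j = contradiction (3 ∣0) 3∤j
  jump m<M (unit {suc j} {r} {k} lj≡ M≤6r 6r<5M M⊥j) 3∤j = by-balance (3 * hits X W ≟ length W)
    where
    instance
      M≢0 : NonZero M
      M≢0 = >-nonZero 0<M
      M²≢0 : NonZero (M * M)
      M²≢0 = m*n≢0 M M
      jM≢0 : NonZero (suc j * M)
      jM≢0 = m*n≢0 (suc j) M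
    n = pred (suc j * M)
    n≡ : suc n ≡ suc j * M
    n≡ = suc-pred (suc j * M)
    X X⁻ : Point
    X  = suc j ÷ M
    X⁻ = n ÷ M * M

    multiple : m * suc j ≡ 6 * r + k * 6 * M
    multiple = trans (eq l (suc j)) (trans (cong (6 *_) lj≡) (eq′ r k M))
      where
      eq : ∀ l j → 3 * (2 * l) * j ≡ 6 * (l * j)
      eq = solve-∀
      eq′ : ∀ r k M → 6 * (r + k * M) ≡ 6 * r + k * 6 * M
      eq′ = solve-∀
    index-m : index X m ≡ (6 * r) ℕ./ M + k * 6
    index-m = begin
      (m * suc j) ℕ./ M                     ≡⟨ /-congˡ multiple ⟩
      (6 * r + k * 6 * M) ℕ./ M             ≡⟨ +-distrib-/-∣ʳ (6 * r) (n∣m*n (k * 6)) ⟩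
      (6 * r) ℕ./ M + (k * 6 * M) ℕ./ M     ≡⟨ cong (_+_ ((6 * r) ℕ./ M)) (m*n/n≡m (k * 6) M) ⟩
      (6 * r) ℕ./ M + k * 6                 ∎
      where open ≡-Reasoning
    same : ∀ {b} → 0 < b → b < M → index X⁻ b ≡ index X b
    same = index-same 0<M n n≡ M⊥j
    central : Central X l
    central = (6 * r) ℕ./ M , k , m≥n⇒m/n>0 M≤6r , m<n*o⇒m/o<n 6r<5M , index-m
    -- As m < M, the index of `m` does not jump either, so both sides are central.
    central⁻ : Central X⁻ l
    central⁻ = (6 * r) ℕ./ M , k , m≥n⇒m/n>0 M≤6r , m<n*o⇒m/o<n 6r<5M ,
      trans (same 0<m m<M) index-m

    hits-differ : hits X W ≢ hits X⁻ W
    -- Only M changes its index, from `j` to `suc j`; equal counts would make 3 divide `suc j`.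
    hits-differ same-hits = 3∤j (middle-suc j (+-cancelʳ-≡ (hits X B) (middle (suc j)) (middle j) (begin
      middle (suc j) + hits X B      ≡⟨ cong (λ i → middle i + hits X B) (index-at 0<M n n≡) ⟨
      hits X (M ∷ B)                 ≡⟨ sum-↭ (map⁺ (hit X) p) ⟨
      hits X W                       ≡⟨ same-hits ⟩
      hits X⁻ W                      ≡⟨ sum-↭ (map⁺ (hit X⁻) p) ⟩
      hits X⁻ (M ∷ B)                ≡⟨ cong₂ (λ i h → middle i + h) (index-before {j = j} 0<M n n≡) same-B ⟩
      middle j + hits X B            ∎)))
      where
      open ≡-Reasoning
      same-B : hits X⁻ B ≡ hits X B
      same-B = hits-cong X⁻ X (All.zipWith (λ (0<b , b<M) → same 0<b b<M) (0<B , B<M))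

    by-balance : Dec (3 * hits X W ≡ length W) → Good (3 * l ∷ m ∷ W)
    by-balance (no unbalanced) = Good-central X l central 3∤W unbalanced
    by-balance (yes balanced)  = Good-central X⁻ l central⁻ 3∤W λ balanced⁻ →
      hits-differ (*-cancelˡ-≡ _ _ 3 (trans balanced (sym balanced⁻)))

  go : Tri (M < m) (M ≡ m) (m < M) → Good (3 * l ∷ m ∷ W)
  go (tri< M<m _ _) = small M<m
  go (tri≈ _ M≡m _) = contradiction (subst (3 ∣_) (sym M≡m) (m∣m*n (2 * l))) 3∤M
  go (tri> _ _ m<M) =
    let u , 3∤j = Unit-3∤ 3∤M (Unit-exists l M 0<l (subst (_< M) (sym (*-assoc 3 2 l)) m<M))
    in jump m<M u 3∤j

-- Induction through the multiples of 3.

filter-↭ : ∀ {P : ℕ → Set} (P? : Decidable P) A → A ↭ filter P? A ++ filter (¬? ∘ P?) A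
filter-↭ P? []      = ↭-refl
filter-↭ P? (a ∷ A) with P? a
... | yes _ = prep a (filter-↭ P? A)
... | no  _ = ↭-trans (prep a (filter-↭ P? A)) (↭-sym (shift a (filter P? A) _))

All-∣⇒map : All (3 ∣_) T → ∃[ T′ ] T ≡ map (3 *_) T′
All-∣⇒map []                     = [] , refl
All-∣⇒map (divides q refl ∷ 3∣T) with All-∣⇒map 3∣T
... | T′ , refl = q ∷ T′ , cong (_∷ map (3 *_) T′) (*-comm q 3)

-- Dividing the multiples of 3 by 3 lowers a strict bound on positive elements, so `bound` drives
-- the recursion. Only sets of at least three elements recurse; if the quotients form a pair m, 2 m,
-- then U is nonempty and `Good-double` applies.
Good-or-pair : ∀ bound A → Unique A → All (0 <_) A → All (_< bound) A → 0 < length A →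
               Good A ⊎ ∃[ m ] A ↭ m ∷ 2 * m ∷ []
Good-or-pair zero        (a ∷ A)          _  _  (() ∷ _) _
-- At x = 1 / (3 a) the value a x is 1/3, the closed end of the middle third.
Good-or-pair (suc bound) (a ∷ [])         _  (0<a ∷ _) _ _ = inj₁ (1 ÷ a , good)
  where
  instance
    a≢0 : NonZero a
    a≢0 = >-nonZero 0<a
  good : 3 ≤ⁿ 3 * hits (1 ÷ a) (a ∷ [])
  good = ≤-reflexive (cong (λ i → 3 * (middle i + 0))
    (sym (trans (/-congˡ {o = a} (*-identityʳ a)) (n/n≡1 a))))
Good-or-pair (suc bound) (a ∷ b ∷ []) ((a≢b ∷ _) ∷ _) (0<a ∷ 0<b ∷ _) _ _
  with <-cmp a b | b ≟ 2 * a | a ≟ 2 * b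
... | _              | yes refl | _        = inj₂ (a , ↭-refl)
... | _              | _        | yes refl = inj₂ (b , swap a b ↭-refl)
... | tri< a<b _ _   | no b≢2a  | _        = inj₁ (Good-pair 0<a a<b b≢2a)
... | tri≈ _ a≡b _   | _        | _        = contradiction a≡b a≢b
... | tri> _ _ b<a   | _        | no a≢2b  =
  inj₁ (Good-resp-↭ {b ∷ a ∷ []} (swap b a ↭-refl) (Good-pair 0<b b<a a≢2b))
Good-or-pair (suc bound) A@(_ ∷ _ ∷ _ ∷ _) !A 0<A A<bound _ =
  inj₁ (split (All-∣⇒map (All.all-filter (3 ∣?_) A)))
  where
  T₃ = filter (3 ∣?_) A
  U₃ = filter (¬? ∘ (3 ∣?_)) A
  A↭ : A ↭ T₃ ++ U₃
  A↭ = filter-↭ (3 ∣?_) A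
  3≤A : 3 ≤ⁿ length A
  3≤A = s≤s (s≤s (s≤s z≤n))
  3∤U : All (λ a → ¬ 3 ∣ a) U₃
  3∤U = All.all-filter (¬? ∘ (3 ∣?_)) A
  0<T : All (0 <_) T₃
  0<T = All.filter⁺ (3 ∣?_) 0<A
  T<bound : All (_< suc bound) T₃
  T<bound = All.filter⁺ (3 ∣?_) A<bound

  with-double : ∀ m U → A ↭ 3 * m ∷ 3 * (2 * m) ∷ U → All (λ a → ¬ 3 ∣ a) U →
                All (0 <_) U → Unique U → Good A
  with-double m []      A↭ _ _ _ = contradiction (subst (3 ≤ⁿ_) (↭-length A↭) 3≤A) λ { (s≤s (s≤s ())) }
  with-double m (a ∷ V) A↭ 3∤U 0<U !U = Good-resp-↭ (↭-sym A↭)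
    (Good-double (*-cancelˡ-< 3 0 m (All.head (All-resp-↭ A↭ 0<A))) 3∤U 0<U !U)

  split : ∃[ T ] T₃ ≡ map (3 *_) T → Good A
  split ([] , T₃≡) = Good-resp-↭ (↭-sym A↭U) (Good-3∤ 3∤U (subst (3 ≤ⁿ_) (↭-length A↭U) 3≤A))
    where
    A↭U : A ↭ U₃
    A↭U = subst (λ T → A ↭ T ++ U₃) T₃≡ A↭
  split (T@(_ ∷ _) , T₃≡) with Good-or-pair bound T
    (Unique.map⁻ (subst Unique T₃≡ (Unique.filter⁺ (3 ∣?_) !A)))
    (All.map (λ {t} → *-cancelˡ-< 3 0 t) (All.map⁻ (subst (All (0 <_)) T₃≡ 0<T)))
    (All.map below (All.zip (All.map⁻ (subst (All (0 <_)) T₃≡ 0<T) ,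
                             All.map⁻ (subst (All (_< suc bound)) T₃≡ T<bound))))
    (s≤s z≤n)
    where
    below : ∀ {t} → 0 < 3 * t × 3 * t < suc bound → t < bound
    below {t} (0<3t , 3t<) = <-≤-trans (m<m+n t (<-≤-trans (*-cancelˡ-< 3 0 t 0<3t) (m≤m+n t _))) (s≤s⁻¹ 3t<)
  ... | inj₁ good     = Good-resp-↭ (↭-sym (subst (λ T → A ↭ T ++ U₃) T₃≡ A↭)) (Good-3* {T} good 3∤U)
  ... | inj₂ (m , T↭) = with-double m U₃
    (↭-trans A↭ (++⁺ʳ U₃ (↭-trans (↭-reflexive T₃≡) (map⁺ (3 *_) T↭))))
    3∤U (All.filter⁺ (¬? ∘ (3 ∣?_)) 0<A) (Unique.filter⁺ (¬? ∘ (3 ∣?_)) !A)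

-- From points to sum-free subsets.

/-superadditive : ∀ m n d .{{_ : NonZero d}} →
  (m + n) ℕ./ d ≡ m ℕ./ d + n ℕ./ d ⊎ (m + n) ℕ./ d ≡ suc (m ℕ./ d + n ℕ./ d)
/-superadditive m n d with m % d + n % d <? d
... | yes <d = inj₁ (+-distrib-/ m n <d)
... | no  ≮d = inj₂ (/-unique {r = ρ ∸ d} (begin
  m + n                              ≡⟨ cong₂ _+_ (m≡m%n+[m/n]*n m d) (m≡m%n+[m/n]*n n d) ⟩
  m % d + i * d + (n % d + j * d)    ≡⟨ eq (m % d) (n % d) i j d ⟩
  ρ + (i + j) * d                    ≡⟨ cong (_+ (i + j) * d) (m∸n+n≡m (≮⇒≥ ≮d)) ⟨
  ρ ∸ d + d + (i + j) * d            ≡⟨ +-assoc (ρ ∸ d) d _ ⟩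
  ρ ∸ d + suc (i + j) * d            ∎)
  (+-cancelʳ-< d (ρ ∸ d) d (subst (_< d + d) (sym (m∸n+n≡m (≮⇒≥ ≮d)))
    (+-mono-< (m%n<n m d) (m%n<n n d)))))
  where
  open ≡-Reasoning
  ρ = m % d + n % d
  i = m ℕ./ d
  j = n ℕ./ d
  eq : ∀ a b i j d → a + i * d + (b + j * d) ≡ a + b + (i + j) * d
  eq = solve-∀

middle≡1⇒ : ∀ n → middle n ≡ 1 → ∃[ k ] n ≡ k * 3 + 1
middle≡1⇒ 1                   _  = 0 , refl
middle≡1⇒ (suc (suc (suc n))) eq with middle≡1⇒ n eq
... | k , refl = suc k , refl

-- Both x and y are 1 modulo 3, so z is 2 or, with the carry, 0 modulo 3.
middle-sum-free : ∀ {x y z} → middle x ≡ 1 → middle y ≡ 1 → z ≡ x + y ⊎ z ≡ suc (x + y) →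
                  middle z ≢ 1
middle-sum-free {x} {y} mx my z≡ mz with middle≡1⇒ x mx | middle≡1⇒ y my | z≡
... | i , refl | j , refl | inj₁ refl = 0≢1+n (trans (sym (trans (cong middle (eq i j)) (middle-periodic (i + j) 2))) mz)
  where
  eq : ∀ i j → i * 3 + 1 + (j * 3 + 1) ≡ (i + j) * 3 + 2
  eq = solve-∀
... | i , refl | j , refl | inj₂ refl = 0≢1+n (trans (sym (trans (cong middle (eq i j)) (middle-periodic (i + j) 3))) mz)
  where
  eq : ∀ i j → suc (i * 3 + 1 + (j * 3 + 1)) ≡ (i + j) * 3 + 3
  eq = solve-∀

middle≡0⊎1 : ∀ n → middle n ≡ 0 ⊎ middle n ≡ 1
middle≡0⊎1 0                   = inj₁ refl
middle≡0⊎1 1                   = inj₂ refl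
middle≡0⊎1 2                   = inj₁ refl
middle≡0⊎1 (suc (suc (suc n))) = middle≡0⊎1 n

-- The elements hit by a point form a sum-free subset, because the index is additive up to a carry
-- of 0 or 1.
hits≤s : ∀ X → Unique A → hits X A ≤ⁿ s A
hits≤s {A} X@(p ÷ q) !A = subst (_≤ⁿ s A) (length-hits A)
  (s-maximal {A} (Unique.filter⁺ hit? !A , proj₁ ∘ member , sum-free))
  where
  hit? : Decidable (λ a → hit X a ≡ 1)
  hit? a = hit X a ≟ 1
  member : ∀ {a} → a ∈ filter hit? A → a ∈ A × hit X a ≡ 1
  member = ∈-filter⁻ hit? {xs = A}
  sum-free : SumFree (filter hit? A)
  sum-free {a} {b} {c} a∈ b∈ c∈ a+b≡c = middle-sum-free {index X a} {index X b}
    (proj₂ (member a∈)) (proj₂ (member b∈)) additive (proj₂ (member c∈))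
    where
    additive : index X c ≡ index X a + index X b ⊎ index X c ≡ suc (index X a + index X b)
    additive rewrite sym a+b≡c | *-distribʳ-+ p a b = /-superadditive (a * p) (b * p) q
  length-hits : ∀ A → length (filter hit? A) ≡ hits X A
  length-hits []      = refl
  length-hits (a ∷ A) with middle≡0⊎1 (index X a)
  ... | inj₁ h≡0 = trans (cong length (filter-reject hit? λ h≡1 → 0≢1+n (trans (sym h≡0) h≡1)))
    (trans (length-hits A) (cong (_+ hits X A) (sym h≡0)))
  ... | inj₂ h≡1 = trans (cong length (filter-accept hit? h≡1))
    (cong₂ _+_ (sym h≡1) (length-hits A))

-- The co-prime case and the rational bound.

∣-gcdAll : ∀ {d} → All (d ∣_) A → d ∣ gcdAll A
∣-gcdAll {d = d} []    = d ∣0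
∣-gcdAll (d∣a ∷ d∣A) = gcd-greatest d∣a (∣-gcdAll d∣A)

m≤3*n⇒m/3≤n/1 : ∀ m n → m ≤ⁿ 3 * n → (+ m) / 3 ≤ (+ n) / 1
m≤3*n⇒m/3≤n/1 m n m≤3n = ℚ.toℚᵘ-cancel-≤
  -- `mkℚᵘ` takes the denominator minus one, so 2 and 0 stand for 3 and 1.
  (ℚᵘ.≤-respˡ-≃ (ℚᵘ.≃-sym (ℚ.toℚᵘ-fromℚᵘ (mkℚᵘ (+ m) 2)))
  (ℚᵘ.≤-respʳ-≃ (ℚᵘ.≃-sym (ℚ.toℚᵘ-fromℚᵘ (mkℚᵘ (+ n) 0)))
  (ℚᵘ.*≤* (subst₂ ℤ._≤_ (ℤₚ.pos-* m 1) (ℤₚ.pos-* n 3)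
    (+≤+ (subst₂ _≤ⁿ_ (sym (*-identityʳ m)) (*-comm 3 n) m≤3n))))))

exceptional-or-large : ∀ A → Unique A → All (0 <_) A → gcdAll A ≡ 1 →
  A ∼[ set ] (1 ∷ 2 ∷ []) ⊎ length A + 2 ≤ⁿ 3 * s A
exceptional-or-large A !A 0<A gcd≡1 = Sum.map exceptional
  (λ (X , good) → ≤-trans good (*-monoʳ-≤ 3 (hits≤s X !A)))
  (Sum.swap (Good-or-pair (suc (max 0 A)) A !A 0<A (All.map s≤s (xs≤max 0 A)) (nonempty A gcd≡1)))
  where
  nonempty : ∀ A → gcdAll A ≡ 1 → 0 < length A
  -- The empty list is excluded because its `gcdAll` is 0.
  nonempty (_ ∷ _) _ = s≤s z≤n
  exceptional : ∃[ m ] A ↭ m ∷ 2 * m ∷ [] → A ∼[ set ] (1 ∷ 2 ∷ [])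
  exceptional (m , A↭) = bag-=⇒ (↭⇒∼bag (subst (λ m → A ↭ m ∷ 2 * m ∷ []) m≡1 A↭))
    where
    m≡1 : m ≡ 1
    m≡1 = ∣1⇒≡1 (subst (m ∣_) gcd≡1
      (∣-gcdAll (All-resp-↭ (↭-sym A↭) (∣-refl ∷ n∣m*n 2 ∷ []))))

theorem1 : (n : ℕ) (A : List ℕ) → Unique A → All (0 <_) A → length A ≡ n → gcdAll A ≡ 1 →
    A ∼[ set ] (1 ∷ 2 ∷ []) ⊎ (+ (n + 2)) / 3 ≤ (+ (s A)) / 1
theorem1 n A !A 0<A refl gcd≡1 = Sum.map₂ (m≤3*n⇒m/3≤n/1 (n + 2) (s A))
  (exceptional-or-large A !A 0<A gcd≡1)
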